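{- (Correctness of Brzozowski's algorithm.) Let $\mathcal{A}$ be a non-deterministic automaton over an alphabet $A$, accepting a language $L\subseteq A^*$. Then the deterministic automaton $$\mathtt{determinize}(\mathtt{transpose}(\mathtt{determinize}(\mathtt{transpose}(\mathcal{A}))))$$ is (up to isomorphism) the minimal deterministic automaton for $L$.
   Context: A non-deterministic automaton over $A$ consists of a set $Q$ of states (not necessarily finite), a set of initial states $I\subseteq Q$, a set of final states $F\subseteq Q$ and a transition relation $\delta_a\subseteq Q\times Q$ for each $a\in A$; it accepts the set of words labelling some path from an initial to a final state. A deterministic automaton is one with a single initial state and with each $\delta_a$ a (total) function $Q\to Q$; it is regarded as a non-deterministic automaton in the obvious way. $\mathtt{transpose}$ takes a non-deterministic automaton, reverses all its transitions and swaps the initial and final states (so it accepts the mirrored language). $\mathtt{determinize}$ takes a non-deterministic automaton, applies the powerset construction (states: subsets of $Q$; initial state: $I$; $a$-transition: $S\mapsto\{q'\mid\exists q\in S,\ (q,q')\in\delta_a\}$; final states: the subsets meeting $F$) and restricts to the states reachable from the initial state. The minimal deterministic automaton for $L$ is the deterministic automaton accepting $L$ which is a quotient of a sub-automaton of every deterministic automaton accepting $L$; concretely, its states are the quotient languages $w^{ -1}L=\{u\in A^*\mid wu\in L\}$ for $w\in A^*$, with initial state $L$, transitions $K\mapsto a^{ -1}K$, and final states those containing $\varepsilon$. -}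

module Defs where

open import Level using (Level; _⊔_; suc; Lift; lift; lower)
open import Data.List.Base using (List; []; _∷_; _++_; [_]; foldl)
open import Data.List.Properties using (++-assoc; foldl-++)
open import Data.Product.Base using (Σ; ∃; _×_; _,_; proj₁; proj₂; swap)
open import Function.Base using (flip)
open import Function.Bundles using (_⇔_)
open import Function.Definitions using (Congruent; Surjective; Bijective)
open import Relation.Binary.Bundles using (Setoid)
open import Relation.Binary.Core using (Rel)
open import Relation.Binary.Definitions using (_Respects_; _Respects₂_)
import Relation.Binary.Construct.On as On
open import Relation.Binary.PropositionalEquality.Core using (subst; sym)
open import Relation.Unary using (Pred; _∈_; _≐_)
open import Relation.Unary.Properties using (≐-refl)
open import Relation.Unary.Relation.Binary.Equality using (≐-setoid)

private
  variable
    a q e i d f l p q′ e′ f′ : Level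
    A : Set a

-- Sets of states are setoids, since subsets and languages, which occur as
-- states below, are compared extensionally.

record NFA (A : Set a) (q e i d f : Level) : Set (a ⊔ suc (q ⊔ e ⊔ i ⊔ d ⊔ f)) where
  field
    states : Setoid q e
  open Setoid states public using (_≈_) renaming (Carrier to State)
  field
    Initial      : Pred State i
    Final        : Pred State f
    δ            : A → Rel State d
    Initial-resp : Initial Respects _≈_
    Final-resp   : Final Respects _≈_
    δ-resp       : ∀ x → δ x Respects₂ _≈_

record DFA (A : Set a) (q e f : Level) : Set (a ⊔ suc (q ⊔ e ⊔ f)) where
  field
    states : Setoid q e
  open Setoid states public using (_≈_) renaming (Carrier to State)
  field
    initial    : State
    Final      : Pred State f
    step       : A → State → State
    Final-resp : Final Respects _≈_
    step-cong  : ∀ x → Congruent _≈_ _≈_ (step x)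

  run : State → List A → State
  run = foldl (flip step)

Language : Set a → (l : Level) → Set (a ⊔ suc l)
Language A l = Pred (List A) l

data Path {A : Set a} (N : NFA A q e i d f) :
          NFA.State N → List A → NFA.State N → Set (a ⊔ q ⊔ d) where
  []  : ∀ {s} → Path N s [] s
  _∷_ : ∀ {x w s t u} → NFA.δ N x s t → Path N t w u → Path N s (x ∷ w) u

language : {A : Set a} (N : NFA A q e i d f) → Language A (a ⊔ q ⊔ i ⊔ d ⊔ f)
language N w = ∃ λ s → ∃ λ t → s ∈ Initial × t ∈ Final × Path N s w t
  where open NFA N

infix 4 _Accepts_ _≅_ _IsQuotientOf_ _IsQuotientOfSubautomatonOf_

_Accepts_ : {A : Set a} → NFA A q e i d f → Language A l → Set (a ⊔ q ⊔ i ⊔ d ⊔ f ⊔ l)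
N Accepts L = language N ≐ L

toNFA : DFA A q e f → NFA A q e e e f
toNFA D = record
  { states       = states
  ; Initial      = λ s → initial ≈ s
  ; Final        = Final
  ; δ            = λ x s t → step x s ≈ t
  ; Initial-resp = λ s≈t i≈s → S.trans i≈s s≈t
  ; Final-resp   = Final-resp
  ; δ-resp       = λ x → (λ t≈u s→t → S.trans s→t t≈u)
                       , (λ s≈t s→u → S.trans (step-cong x (S.sym s≈t)) s→u)
  }
  where
  open DFA D
  module S = Setoid states

transpose : NFA A q e i d f → NFA A q e f d i
transpose N = record
  { states       = states
  ; Initial      = Final
  ; Final        = Initial
  ; δ            = λ x → flip (δ x)
  ; Initial-resp = Final-resp
  ; Final-resp   = Initial-resp
  ; δ-resp       = λ x → swap (δ-resp x)
  }
  where open NFA N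

Subset : Setoid q e → (p : Level) → Set (q ⊔ e ⊔ suc p)
Subset S p = Σ (Pred Carrier p) (_Respects _≈_)
  where open Setoid S

-- The level q ⊔ i ⊔ d is the least one closed under images along δ that can
-- also hold the set of initial states; Lift only serves to reach it.

powerset : NFA A q e i d f →
           DFA A (e ⊔ suc (q ⊔ i ⊔ d)) (q ⊔ i ⊔ d) (q ⊔ i ⊔ d ⊔ f)
powerset {q = q} {i = i} {d = d} N = record
  { states     = On.setoid {B = Subset states (q ⊔ i ⊔ d)}
                   (≐-setoid State (q ⊔ i ⊔ d)) proj₁
  ; initial    = (λ s → Lift (q ⊔ d) (Initial s))
               , (λ s≈t s∈I → lift (Initial-resp s≈t (lower s∈I)))
  ; Final      = λ (S , _) → ∃ λ s → s ∈ S × s ∈ Final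
  ; step       = λ x (S , _) →
                   (λ t → ∃ λ s → s ∈ S × δ x s t)
                 , (λ t≈u (s , s∈S , s→t) → s , s∈S , proj₁ (δ-resp x) t≈u s→t)
  ; Final-resp = λ (S⊆T , _) (s , s∈S , s∈F) → s , S⊆T s∈S , s∈F
  ; step-cong  = λ x (S⊆T , T⊆S) →
                   (λ (s , s∈S , s→t) → s , S⊆T s∈S , s→t)
                 , (λ (s , s∈T , s→t) → s , T⊆S s∈T , s→t)
  }
  where open NFA N

record Subautomaton {A : Set a} (D : DFA A q e f) (p : Level) :
                    Set (a ⊔ q ⊔ e ⊔ suc p) where
  open DFA D
  field
    Member      : Pred State p
    Member-resp : Member Respects _≈_
    initial∈    : initial ∈ Member
    step∈       : ∀ x {s} → s ∈ Member → step x s ∈ Member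

restrict : (D : DFA A q e f) → Subautomaton D p → DFA A (q ⊔ p) e f
restrict D P = record
  { states     = On.setoid {B = ∃ Member} states proj₁
  ; initial    = initial , initial∈
  ; Final      = λ (s , _) → s ∈ Final
  ; step       = λ x (s , s∈P) → step x s , step∈ x s∈P
  ; Final-resp = λ s≈t → Final-resp s≈t
  ; step-cong  = λ x s≈t → step-cong x s≈t
  }
  where
  open DFA D
  open Subautomaton P

reachable : {A : Set a} (D : DFA A q e f) → Subautomaton D (a ⊔ e)
reachable D = record
  { Member      = λ s → ∃ λ w → run initial w ≈ s
  ; Member-resp = λ s≈t (w , w→s) → w , S.trans w→s s≈t
  ; initial∈    = [] , S.refl
  ; step∈       = λ x {s} (w , w→s) → w ++ [ x ] ,
      subst (_≈ step x s) (sym (foldl-++ (flip step) initial w [ x ]))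
        (step-cong x w→s)
  }
  where
  open DFA D
  module S = Setoid states

determinize : {A : Set a} → NFA A q e i d f →
              DFA A (a ⊔ e ⊔ suc (q ⊔ i ⊔ d)) (q ⊔ i ⊔ d) (q ⊔ i ⊔ d ⊔ f)
determinize N = restrict (powerset N) (reachable (powerset N))

record Homomorphism {A : Set a} (D : DFA A q e f) (D′ : DFA A q′ e′ f′) :
                    Set (a ⊔ q ⊔ e ⊔ f ⊔ q′ ⊔ e′ ⊔ f′) where
  private
    module D  = DFA D
    module D′ = DFA D′
  field
    map         : D.State → D′.State
    map-cong    : Congruent D._≈_ D′._≈_ map
    map-initial : map D.initial D′.≈ D′.initial
    map-step    : ∀ x s → map (D.step x s) D′.≈ D′.step x (map s)
    map-Final   : ∀ s → s ∈ D.Final ⇔ map s ∈ D′.Final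

_≅_ : {A : Set a} → DFA A q e f → DFA A q′ e′ f′ → Set (a ⊔ q ⊔ e ⊔ f ⊔ q′ ⊔ e′ ⊔ f′)
D ≅ D′ = Σ (Homomorphism D D′) λ h →
  Bijective (DFA._≈_ D) (DFA._≈_ D′) (Homomorphism.map h)

-- Up to isomorphism, quotients are the images of surjective homomorphisms.

_IsQuotientOf_ : {A : Set a} → DFA A q e f → DFA A q′ e′ f′ →
                 Set (a ⊔ q ⊔ e ⊔ f ⊔ q′ ⊔ e′ ⊔ f′)
M IsQuotientOf D = Σ (Homomorphism D M) λ h →
  Surjective (DFA._≈_ D) (DFA._≈_ M) (Homomorphism.map h)

-- a ⊔ e′ is the level of the subset of reachable states of D.

_IsQuotientOfSubautomatonOf_ : {A : Set a} → DFA A q e f → DFA A q′ e′ f′ →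
                               Set (suc (a ⊔ e′) ⊔ q ⊔ e ⊔ f ⊔ q′ ⊔ f′)
_IsQuotientOfSubautomatonOf_ {a = a} {e′ = e′} M D =
  Σ (Subautomaton D (a ⊔ e′)) λ P → M IsQuotientOf restrict D P

infixr 8 _⁻¹_

_⁻¹_ : List A → Language A l → Language A l
(w ⁻¹ L) u = w ++ u ∈ L

minimal : {A : Set a} → Language A l → DFA A (a ⊔ suc l) (a ⊔ l) l
minimal {l = l} {A = A} L = record
  { states     = On.setoid {B = Σ (Language A l) λ K → ∃ λ w → K ≐ w ⁻¹ L}
                   (≐-setoid (List A) l) proj₁
  ; initial    = L , [] , ≐-refl
  ; Final      = λ (K , _) → [] ∈ K
  ; step       = λ x (K , w , K⊆ , ⊆K) → [ x ] ⁻¹ K , w ++ [ x ] ,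
                   (λ {u} xu∈K → subst L (sym (++-assoc w [ x ] u)) (K⊆ xu∈K)) ,
                   (λ {u} wxu∈L → ⊆K (subst L (++-assoc w [ x ] u) wxu∈L))
  ; Final-resp = λ (K⊆K′ , _) ε∈K → K⊆K′ ε∈K
  ; step-cong  = λ x (K⊆K′ , K′⊆K) → (λ xu∈K → K⊆K′ xu∈K) , (λ xu∈K′ → K′⊆K xu∈K′)
  }

{-# OPTIONS --safe #-}

-- Sending a reachable state run(w) of a deterministic automaton accepting L to
-- w⁻¹L is always a well-defined surjective homomorphism onto the minimal
-- automaton, so determinize(transpose D) is minimal as soon as this map is
-- injective.  When all states of the deterministic automaton D are reachable
-- and D accepts the mirror image of L, it is: the subset of states reached by
-- w in the transpose of D consists of the t from which D accepts reverse w,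
-- and for t = run(v) this says that reverse v ∈ w⁻¹L.  So the subset is
-- determined by w⁻¹L.

module Submission where

open import Defs
open import Data.List.Base using (List; []; _∷_; _++_; [_]; reverse)
open import Data.List.Properties
  using (++-assoc; foldl-++; unfold-reverse; reverse-++; reverse-involutive)
open import Data.Product.Base using (∃; _×_; _,_; proj₁; proj₂)
open import Function.Base using (flip; _∘_; _⟨_⟩_)
open import Function.Bundles using (_⇔_; mk⇔; module Equivalence)
import Function.Construct.Composition as Composition
open import Function.Construct.Composition using (_⇔-∘_)
open import Function.Construct.Identity using (⇔-id)
import Function.Construct.Symmetry as Symmetry
open import Function.Construct.Symmetry using (⇔-sym)
open import Function.Related.Propositional using (module EquationalReasoning)
open import Level using (Level; _⊔_; lift; lower)
open import Relation.Binary.Bundles using (Setoid)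
open import Relation.Binary.PropositionalEquality.Core
  using (_≡_; refl; sym; trans; cong; subst)
open import Relation.Unary using (Pred; _∈_; _≐_; _⊢_)
open import Relation.Unary.Properties using (≐-sym; ≐-trans)

private
  variable
    a q e i d f l q′ e′ f′ q″ e″ f″ p : Level
    A : Set a

-- Equality of predicates as pointwise equivalence.

≐⇒⇔ : {P : Pred A p} {Q : Pred A q} → P ≐ Q → ∀ {x} → x ∈ P ⇔ x ∈ Q
≐⇒⇔ (P⊆Q , Q⊆P) = mk⇔ P⊆Q Q⊆P

⇔⇒≐ : {P : Pred A p} {Q : Pred A q} → (∀ x → x ∈ P ⇔ x ∈ Q) → P ≐ Q
⇔⇒≐ P⇔Q = (λ {x} → Equivalence.to (P⇔Q x)) , (λ {x} → Equivalence.from (P⇔Q x))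

∈-cong-≡ : (P : Pred A p) {x y : A} → x ≡ y → x ∈ P ⇔ y ∈ P
∈-cong-≡ P refl = ⇔-id _

-- Runs and paths of a deterministic automaton.

module _ {A : Set a} (D : DFA A q e f) where
  open DFA D
  private module S = Setoid states

  run-++ : ∀ s v w → run s (v ++ w) ≡ run (run s v) w
  run-++ = foldl-++ (flip step)

  run-cong : ∀ w {s t} → s ≈ t → run s w ≈ run t w
  run-cong []      s≈t = s≈t
  run-cong (x ∷ w) s≈t = run-cong w (step-cong x s≈t)

  run-Final-cong : ∀ w {s t} → s ≈ t → run s w ∈ Final ⇔ run t w ∈ Final
  run-Final-cong w s≈t =
    mk⇔ (Final-resp (run-cong w s≈t)) (Final-resp (run-cong w (S.sym s≈t)))

  run-path : ∀ s w → Path (toNFA D) s w (run s w)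
  run-path s []      = []
  run-path s (x ∷ w) = S.refl ∷ run-path (step x s) w

  path-run : ∀ {s w t} → Path (toNFA D) s w t → run s w ≈ t
  path-run []                     = S.refl
  path-run (_∷_ {w = w} s→t path) = S.trans (run-cong w s→t) (path-run path)

  path-to-Final⇔run : ∀ s w →
    (∃ λ t → t ∈ Final × Path (toNFA D) s w t) ⇔ run s w ∈ Final
  path-to-Final⇔run s w = mk⇔
    (λ (t , t∈F , path) → Final-resp (S.sym (path-run path)) t∈F)
    (λ run∈F → run s w , run∈F , run-path s w)

  toNFA-accepts-run : toNFA D Accepts (λ w → run initial w ∈ Final)
  toNFA-accepts-run =
      (λ {w} (s , t , i≈s , t∈F , path) →
        -- The path may start at any `s` equal to `initial`, so acceptance from `s` is carried back
        -- to `initial`.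
        Equivalence.from (run-Final-cong w i≈s)
          (Equivalence.to (path-to-Final⇔run s w) (t , t∈F , path)))
    , (λ {w} run∈F → initial , run initial w , S.refl , run∈F , run-path initial w)

  run∈Final⇔∈ : {L : Language A l} → toNFA D Accepts L →
                ∀ w → run initial w ∈ Final ⇔ w ∈ L
  run∈Final⇔∈ accepts w = ≐⇒⇔ (≐-trans (≐-sym toNFA-accepts-run) accepts)

-- Transposition and mirrored words.

module _ {A : Set a} (N : NFA A q e i d f) where
  open NFA N

  path-snoc : ∀ {s w t x u} → Path N s w t → δ x t u → Path N s (w ++ [ x ]) u
  path-snoc []           t→u = t→u ∷ []
  path-snoc (s→ ∷ path) t→u = s→ ∷ path-snoc path t→u

  path-transpose : ∀ {s w t} → Path (transpose N) s w t → Path N t (reverse w) s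
  path-transpose []                             = []
  path-transpose (_∷_ {x = x} {w = w} t→s path) =
    subst (λ v → Path N _ v _) (sym (unfold-reverse x w))
      (path-snoc (path-transpose path) t→s)

-- Since `transpose (transpose N)` is `N` by computation, this is `path-transpose` for the
-- transposed automaton, up to a double reversal of the word.
path-untranspose : (N : NFA A q e i d f) → ∀ {s w t} →
                   Path N t (reverse w) s → Path (transpose N) s w t
path-untranspose N {w = w} path =
  subst (λ v → Path (transpose N) _ v _) (reverse-involutive w)
    (path-transpose (transpose N) path)

transpose-accepts : {A : Set a} (N : NFA A q e i d f) {L : Language A l} →
                    N Accepts L → transpose N Accepts (reverse ⊢ L)
transpose-accepts N (N⊆L , L⊆N) =
    (λ (s , t , s∈F , t∈I , path) → N⊆L (t , s , t∈I , s∈F , path-transpose N path))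
  , (λ w∈L → let s , t , s∈I , t∈F , path = L⊆N w∈L in
      t , s , t∈F , s∈I , path-untranspose N path)

transpose-accepts-mirror : {A : Set a} (N : NFA A q e i d f) {L : Language A l} →
                           N Accepts (reverse ⊢ L) → transpose N Accepts L
transpose-accepts-mirror N {L} accepts = ≐-trans (transpose-accepts N accepts)
  (⇔⇒≐ λ w → ∈-cong-≡ L (reverse-involutive w))

-- The powerset construction.

module _ {A : Set a} (N : NFA A q e i d f) where
  open NFA N
  private module P = DFA (powerset N)

  -- The starting subset `S` is arbitrary because the induction on the word replaces it by
  -- `P.step x S`.
  powerset-run : ∀ S w {t} →
    t ∈ proj₁ (P.run S w) ⇔ (∃ λ s → s ∈ proj₁ S × Path N s w t)
  powerset-run S []      = mk⇔ (λ t∈S → _ , t∈S , []) λ { (_ , t∈S , []) → t∈S }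
  powerset-run S (x ∷ w) = mk⇔
      (λ (_ , (s , s∈S , s→t) , path) → s , s∈S , s→t ∷ path)
      (λ { (s , s∈S , s→t ∷ path) → _ , (s , s∈S , s→t) , path })
    ⇔-∘ powerset-run (P.step x S) w

  powerset-accepts : {L : Language A l} → N Accepts L → toNFA (powerset N) Accepts L
  powerset-accepts accepts = ≐-trans (toNFA-accepts-run (powerset N)) (≐-trans
    ( (λ {w} (t , t∈run , t∈F) →
        let s , s∈I , path = Equivalence.to (powerset-run P.initial w) t∈run in
        s , t , lower s∈I , t∈F , path)
    , (λ {w} (s , t , s∈I , t∈F , path) →
        t , Equivalence.from (powerset-run P.initial w) (s , lift s∈I , path) , t∈F))
    accepts)

-- Sub-automata and accessibility.

module _ {A : Set a} (D : DFA A q e f) (P : Subautomaton D p) where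

  run-restrict : ∀ s w → proj₁ (DFA.run (restrict D P) s w) ≡ DFA.run D (proj₁ s) w
  run-restrict s []      = refl
  run-restrict s (x ∷ w) = run-restrict (DFA.step (restrict D P) x s) w

  restrict-accepts : {L : Language A l} → toNFA D Accepts L → toNFA (restrict D P) Accepts L
  restrict-accepts accepts = ≐-trans (toNFA-accepts-run (restrict D P)) (⇔⇒≐ λ w →
    run∈Final⇔∈ D accepts w
      ⇔-∘ ∈-cong-≡ (DFA.Final D) (run-restrict (DFA.initial (restrict D P)) w))

determinize-accepts : {A : Set a} (N : NFA A q e i d f) {L : Language A l} →
                      N Accepts L → toNFA (determinize N) Accepts L
determinize-accepts N accepts =
  restrict-accepts (powerset N) (reachable (powerset N)) (powerset-accepts N accepts)

Accessible : {A : Set a} → DFA A q e f → Set (a ⊔ q ⊔ e)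
Accessible D = ∀ s → ∃ λ w → run initial w ≈ s
  where open DFA D

-- The word stored in a state of the restriction reaches it there too, because runs agree on first
-- components.
restrict-reachable-accessible : {A : Set a} (D : DFA A q e f) →
                                Accessible (restrict D (reachable D))
restrict-reachable-accessible D (s , w , w→s) = w ,
  subst (_≈ s) (sym (run-restrict D (reachable D) _ w)) w→s
  where open DFA D

-- Reachable states and residual languages.

module _ {A : Set a} (D : DFA A q e f) {L : Language A l} (accepts : toNFA D Accepts L) where
  open DFA D
  open EquationalReasoning
  private
    module S = Setoid states
    R = restrict D (reachable D)

  residual⇔run : ∀ {s} w → run initial w ≈ s → ∀ u → u ∈ w ⁻¹ L ⇔ run s u ∈ Final
  residual⇔run {s} w w→s u = begin
    w ++ u ∈ L                         ∼⟨ ⇔-sym (run∈Final⇔∈ D accepts (w ++ u)) ⟩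
    run initial (w ++ u) ∈ Final       ∼⟨ ∈-cong-≡ Final (run-++ D initial w u) ⟩
    run (run initial w) u ∈ Final      ∼⟨ run-Final-cong D u w→s ⟩
    run s u ∈ Final                    ∎

  residual : Homomorphism R (minimal L)
  residual = record
    { map         = λ (s , w , w→s) → w ⁻¹ L , w , (λ wu∈L → wu∈L) , (λ wu∈L → wu∈L)
    -- The image does not depend on the stored word: `v ⁻¹ L` and `w ⁻¹ L` are both the language
    -- accepted from `t`.
    ; map-cong    = λ { {s , v , v→s} {t , w , w→t} s≈t → ⇔⇒≐ λ u →
                      ⇔-sym (residual⇔run w w→t u)
                        ⇔-∘ residual⇔run v (S.trans v→s s≈t) u }
    ; map-initial = (λ u∈L → u∈L) , (λ u∈L → u∈L)
    ; map-step    = λ x (s , w , w→s) → ⇔⇒≐ λ u → ∈-cong-≡ L (++-assoc w [ x ] u)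
    ; map-Final   = λ (s , w , w→s) → ⇔-sym (residual⇔run w w→s [])
    }

  minimal-quotient-of-reachable : minimal L IsQuotientOf R
  minimal-quotient-of-reachable = residual , λ (K , w , K≐w⁻¹L) →
    (run initial w , w , S.refl) ,
    -- Surjectivity asks for the image of every `t` equal to the chosen preimage, hence the use of
    -- `map-cong`.
    λ {t} t≈s → ≐-trans (Homomorphism.map-cong residual {t} {_ , w , S.refl} t≈s)
                        (≐-sym K≐w⁻¹L)

-- Inverting isomorphisms and composing quotients.

≅-sym : {A : Set a} {D : DFA A q e f} {E : DFA A q′ e′ f′} → D ≅ E → E ≅ D
≅-sym {D = D} {E = E} (h , bij@(inj , surj)) = record
  { map         = g
  -- This law and the next two are checked after applying the injective `map`, where `hg` cancels
  -- `map` against `g`.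
  ; map-cong    = λ {s} {t} s≈t → inj (T.trans (hg s) (T.trans s≈t (T.sym (hg t))))
  ; map-initial = inj (T.trans (hg E.initial) (T.sym map-initial))
  ; map-step    = λ x s → inj (T.trans (hg (E.step x s))
                    (T.trans (E.step-cong x (T.sym (hg s))) (T.sym (map-step x (g s)))))
  ; map-Final   = λ s → ⇔-sym (map-Final (g s)) ⇔-∘ run-Final-cong E [] (T.sym (hg s))
  } , Symmetry.bijective {≈₁ = DFA._≈_ D} {≈₂ = E._≈_} bij S.refl T.sym T.trans map-cong
  where
  open Homomorphism h
  module E = DFA E
  module S = Setoid (DFA.states D)
  module T = Setoid E.states
  g : E.State → DFA.State D
  g s = proj₁ (surj s)
  hg : ∀ s → map (g s) E.≈ s
  hg s = proj₂ (surj s) S.refl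

IsQuotientOf-trans : {A : Set a} {B : DFA A q e f} {C : DFA A q′ e′ f′} {D : DFA A q″ e″ f″} →
                     B IsQuotientOf C → C IsQuotientOf D → B IsQuotientOf D
IsQuotientOf-trans {B = B} {C} {D} (g , g-surj) (h , h-surj) = record
  { map         = g.map ∘ h.map
  ; map-cong    = g.map-cong ∘ h.map-cong
  ; map-initial = T.trans (g.map-cong h.map-initial) g.map-initial
  ; map-step    = λ x s → T.trans (g.map-cong (h.map-step x s)) (g.map-step x (h.map s))
  ; map-Final   = λ s → g.map-Final (h.map s) ⇔-∘ h.map-Final s
  } , Composition.surjective (DFA._≈_ D) (DFA._≈_ C) (DFA._≈_ B) h-surj g-surj
  where
  module g = Homomorphism g
  module h = Homomorphism h
  module T = Setoid (DFA.states B)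

≅⇒IsQuotientOf : {A : Set a} {D : DFA A q e f} {E : DFA A q′ e′ f′} → D ≅ E → E IsQuotientOf D
≅⇒IsQuotientOf (h , _ , surj) = h , surj

-- Determinizing the transpose of an accessible automaton.

module _ {A : Set a} (D : DFA A q e f) where
  open DFA D
  open EquationalReasoning
  private
    N = transpose (toNFA D)
    module P = DFA (powerset N)

  powerset-transpose-run : ∀ w t → t ∈ proj₁ (P.run P.initial w) ⇔ run t (reverse w) ∈ Final
  powerset-transpose-run w t = begin
    t ∈ proj₁ (P.run P.initial w)
      ∼⟨ powerset-run N P.initial w ⟩
    (∃ λ s → s ∈ proj₁ P.initial × Path N s w t)
      ∼⟨ mk⇔ (λ (s , s∈F , path) → s , lower s∈F , path-transpose (toNFA D) path)
             (λ (s , s∈F , path) → s , lift s∈F , path-untranspose (toNFA D) path) ⟩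
    (∃ λ s → s ∈ Final × Path (toNFA D) t (reverse w) s)
      ∼⟨ path-to-Final⇔run D t (reverse w) ⟩
    run t (reverse w) ∈ Final ∎

  determinize-transpose-minimal : {L : Language A l} → Accessible D →
    toNFA D Accepts (reverse ⊢ L) → determinize N ≅ minimal L
  determinize-transpose-minimal {L = L} accessible accepts =
    residual (powerset N) accepts′ , (λ {S} {T} → inj {S} {T}) ,
    proj₂ (minimal-quotient-of-reachable (powerset N) accepts′)
    where
    accepts′ : toNFA (powerset N) Accepts L
    accepts′ = powerset-accepts N (transpose-accepts-mirror (toNFA D) accepts)

    ∈subset⇔∈residual : ∀ {S} w → P.run P.initial w P.≈ S →
      ∀ {t} v → run initial v ≈ t → t ∈ proj₁ S ⇔ reverse v ∈ w ⁻¹ L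
    ∈subset⇔∈residual {S} w w→S {t} v v→t = begin
      t ∈ proj₁ S
        ∼⟨ ⇔-sym (≐⇒⇔ w→S) ⟩
      t ∈ proj₁ (P.run P.initial w)
        ∼⟨ powerset-transpose-run w t ⟩
      run t (reverse w) ∈ Final
        -- The language of `D` is `reverse ⊢ L`, so `reverse w` lies in its residual at `v` exactly
        -- when `reverse (v ++ reverse w)` lies in `L`.
        ∼⟨ ⇔-sym (residual⇔run D accepts v v→t (reverse w)) ⟩
      reverse (v ++ reverse w) ∈ L
        ∼⟨ ∈-cong-≡ L (trans (reverse-++ v (reverse w))
                             (cong (_++ reverse v) (reverse-involutive w))) ⟩
      w ++ reverse v ∈ L ∎

    inj : ∀ {S T} →
          Homomorphism.map (residual (powerset N) accepts′) S
            ⟨ DFA._≈_ (minimal L) ⟩ Homomorphism.map (residual (powerset N) accepts′) T →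
          S ⟨ DFA._≈_ (determinize N) ⟩ T
    inj {S , v , v→S} {T , w , w→T} v⁻¹L≐w⁻¹L = ⇔⇒≐ λ t →
      -- Accessibility names `t` by a word `u`, so that membership of `t` becomes membership of
      -- `reverse u` in a residual of `L`.
      let u , u→t = accessible t in
      begin
        t ∈ proj₁ S           ∼⟨ ∈subset⇔∈residual {S} v v→S u u→t ⟩
        reverse u ∈ v ⁻¹ L    ∼⟨ ≐⇒⇔ v⁻¹L≐w⁻¹L ⟩
        reverse u ∈ w ⁻¹ L    ∼⟨ ⇔-sym (∈subset⇔∈residual {T} w w→T u u→t) ⟩
        t ∈ proj₁ T           ∎

mainTheorem5 : ∀ {a q e i d f l q′ e′ f′ : Level} {A : Set a}
    (𝒜 : NFA A q e i d f) (L : Language A l) → 𝒜 Accepts L →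
    let M = determinize (transpose (toNFA (determinize (transpose 𝒜)))) in
    (M ≅ minimal L)
    × (toNFA M Accepts L)
    × ((D : DFA A q′ e′ f′) → toNFA D Accepts L → M IsQuotientOfSubautomatonOf D)
mainTheorem5 𝒜 L accepts =
    M≅minimal
  , determinize-accepts N N-accepts
  -- The reachable part of `D` maps onto `minimal L` by residuals, and the inverse isomorphism
  -- continues this map onto the constructed automaton.
  , λ D D-accepts → reachable D ,
      IsQuotientOf-trans (≅⇒IsQuotientOf (≅-sym M≅minimal))
                         (minimal-quotient-of-reachable D D-accepts)
  where
  D₁ = determinize (transpose 𝒜)
  N  = transpose (toNFA D₁)

  D₁-accepts : toNFA D₁ Accepts (reverse ⊢ L)
  D₁-accepts = determinize-accepts (transpose 𝒜) (transpose-accepts 𝒜 accepts)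

  N-accepts : N Accepts L
  N-accepts = transpose-accepts-mirror (toNFA D₁) D₁-accepts

  M≅minimal : determinize N ≅ minimal L
  -- The first round supplies both hypotheses: its restriction to reachable states gives
  -- accessibility, its transposition the mirrored language.
  M≅minimal = determinize-transpose-minimal D₁
    (restrict-reachable-accessible (powerset (transpose 𝒜))) D₁-accepts
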